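{- Let $(\mu_\circ,\eta_\circ,\delta_\circ,\epsilon_\circ)$ and $(\mu_\bullet,\eta_\bullet,\delta_\bullet,\epsilon_\bullet)$ form a GHZ/W-pair on an object $Q$ of a symmetric monoidal category $\mathbf V$ with no non-trivial invertible scalars (invertible scalar factors being disregarded, as in $\mathbf{FHilb}_p$), and assume $\{\eta_\bullet,\tau\circ\eta_\bullet\}$ is a plugging set for $Q$. Let $\times:Q\to Q$ satisfy $\times\circ\times=1_Q$ and $\times\circ\mu_\circ=\mu_\circ\circ(\times\otimes 1_Q)$, and assume $\{\eta_\circ,\times\circ\eta_\circ\}$ is a plugging set for $Q$. Then for every $\psi:I\to Q$, $$\mu_\bullet\circ(\psi\otimes\times\circ\psi)=\big(\epsilon_\circ\circ\mu_\bullet\circ(\psi\otimes\times\circ\psi)\big)\cdot\eta_\bullet,$$ i.e. $\times$ acts as an additive inverse with respect to the addition $\mu_\bullet$ with unit $\eta_\bullet$.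
   Context: Let $(\mathbf V,\otimes,I,\sigma)$ be a symmetric monoidal category; scalars are morphisms $I\to I$ and $s\cdot f$ denotes $s\otimes f$ with $I\otimes X\cong X$. A commutative Frobenius algebra (CFA) on $Q$ is a commutative monoid $(Q,\mu,\eta)$ and cocommutative comonoid $(Q,\delta,\epsilon)$ with $(1\otimes\mu)(\delta\otimes 1)=\delta\mu=(\mu\otimes1)(1\otimes\delta)$. It is special if $\mu\circ\delta=1_Q$, and anti-special if $c\cdot(\mu\circ\delta)=(\mu\circ\delta\circ\eta)\circ(\epsilon\circ\mu\circ\delta)$ where $c=\epsilon\circ\mu\circ\delta\circ\eta$. A GHZ-structure is a special CFA $(\mu_\circ,\eta_\circ,\delta_\circ,\epsilon_\circ)$, a W-structure an anti-special CFA $(\mu_\bullet,\eta_\bullet,\delta_\bullet,\epsilon_\bullet)$, both on $Q$. Define $\tau:=(\epsilon_\bullet\mu_\bullet\otimes 1_Q)\circ(1_Q\otimes\delta_\circ\eta_\circ):Q\to Q$. They form a GHZ/W-pair if: ($\alpha$) $\tau=(\epsilon_\circ\mu_\circ\otimes 1_Q)\circ(1_Q\otimes\delta_\bullet\eta_\bullet)$; ($\beta$) $\delta_\circ\circ\eta_\bullet=\eta_\bullet\otimes\eta_\bullet$; ($\gamma$) $\delta_\circ\circ\tau=(\tau\otimes\tau)\circ\delta_\circ$; ($\xi$) $(\epsilon_\bullet\mu_\bullet\delta_\bullet\eta_\bullet)\cdot(\tau\circ\eta_\bullet)=\mu_\bullet\circ\delta_\bullet\circ\eta_\bullet$. A set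 of points $\{\psi_i:I\to Q\}$ is a plugging set if for all objects $A$ and $f,g:Q\to A$, $f=g$ iff $f\circ\psi_i=g\circ\psi_i$ for all $i$. -}

module Defs where

open import Level using (Level; _⊔_) renaming (suc to lsuc)
open import Data.Product using (_×_; Σ; ∃)
open import Data.Bool using (Bool; true; false)
open import Relation.Binary using (Rel; IsEquivalence)
open import Function.Bundles using (_⇔_)

record SymmetricMonoidalCategory (o ℓ e : Level) : Set (lsuc (o ⊔ ℓ ⊔ e)) where
  infix  4 _≈_
  infixr 9 _∘_
  infixr 10 _⊗₀_ _⊗₁_
  field
    Obj : Set o
    _⇒_ : Obj → Obj → Set ℓ
    _≈_ : ∀ {A B} → Rel (A ⇒ B) e
    id  : ∀ {A} → A ⇒ A
    _∘_ : ∀ {A B C} → B ⇒ C → A ⇒ B → A ⇒ C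
    ≈-equiv   : ∀ {A B} → IsEquivalence (_≈_ {A} {B})
    ∘-resp-≈  : ∀ {A B C} {f h : B ⇒ C} {g i : A ⇒ B} → f ≈ h → g ≈ i → f ∘ g ≈ h ∘ i
    assoc     : ∀ {A B C D} {f : A ⇒ B} {g : B ⇒ C} {h : C ⇒ D} → (h ∘ g) ∘ f ≈ h ∘ (g ∘ f)
    identityˡ : ∀ {A B} {f : A ⇒ B} → id ∘ f ≈ f
    identityʳ : ∀ {A B} {f : A ⇒ B} → f ∘ id ≈ f

    unit : Obj
    _⊗₀_ : Obj → Obj → Obj
    _⊗₁_ : ∀ {A B C D} → A ⇒ B → C ⇒ D → (A ⊗₀ C) ⇒ (B ⊗₀ D)
    ⊗-resp-≈ : ∀ {A B C D} {f f′ : A ⇒ B} {g g′ : C ⇒ D} → f ≈ f′ → g ≈ g′ → f ⊗₁ g ≈ f′ ⊗₁ g′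
    ⊗-identity : ∀ {A B} → id {A} ⊗₁ id {B} ≈ id
    ⊗-homomorphism : ∀ {A B C D E F} {f : A ⇒ B} {g : B ⇒ C} {h : D ⇒ E} {k : E ⇒ F} →
                     (g ∘ f) ⊗₁ (k ∘ h) ≈ (g ⊗₁ k) ∘ (f ⊗₁ h)

    l⇒ : ∀ {A} → (unit ⊗₀ A) ⇒ A
    l⇐ : ∀ {A} → A ⇒ (unit ⊗₀ A)
    r⇒ : ∀ {A} → (A ⊗₀ unit) ⇒ A
    r⇐ : ∀ {A} → A ⇒ (A ⊗₀ unit)
    a⇒ : ∀ {A B C} → ((A ⊗₀ B) ⊗₀ C) ⇒ (A ⊗₀ (B ⊗₀ C))
    a⇐ : ∀ {A B C} → (A ⊗₀ (B ⊗₀ C)) ⇒ ((A ⊗₀ B) ⊗₀ C)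
    σ  : ∀ {A B} → (A ⊗₀ B) ⇒ (B ⊗₀ A)

    l-isoˡ : ∀ {A} → l⇐ {A} ∘ l⇒ {A} ≈ id
    l-isoʳ : ∀ {A} → l⇒ {A} ∘ l⇐ {A} ≈ id
    r-isoˡ : ∀ {A} → r⇐ {A} ∘ r⇒ {A} ≈ id
    r-isoʳ : ∀ {A} → r⇒ {A} ∘ r⇐ {A} ≈ id
    a-isoˡ : ∀ {A B C} → a⇐ {A} {B} {C} ∘ a⇒ {A} {B} {C} ≈ id
    a-isoʳ : ∀ {A B C} → a⇒ {A} {B} {C} ∘ a⇐ {A} {B} {C} ≈ id

    l-natural : ∀ {A B} {f : A ⇒ B} → l⇒ {B} ∘ (id {unit} ⊗₁ f) ≈ f ∘ l⇒ {A}
    r-natural : ∀ {A B} {f : A ⇒ B} → r⇒ {B} ∘ (f ⊗₁ id {unit}) ≈ f ∘ r⇒ {A}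
    a-natural : ∀ {A B C D E F} {f : A ⇒ B} {g : C ⇒ D} {h : E ⇒ F} →
                a⇒ {B} {D} {F} ∘ ((f ⊗₁ g) ⊗₁ h) ≈ (f ⊗₁ (g ⊗₁ h)) ∘ a⇒ {A} {C} {E}
    σ-natural : ∀ {A B C D} {f : A ⇒ B} {g : C ⇒ D} →
                σ {B} {D} ∘ (f ⊗₁ g) ≈ (g ⊗₁ f) ∘ σ {A} {C}

    triangle : ∀ {A B} → (id {A} ⊗₁ l⇒ {B}) ∘ a⇒ {A} {unit} {B} ≈ r⇒ {A} ⊗₁ id {B}
    pentagon : ∀ {A B C D} →
               (id {A} ⊗₁ a⇒ {B} {C} {D}) ∘ (a⇒ {A} {B ⊗₀ C} {D} ∘ (a⇒ {A} {B} {C} ⊗₁ id {D}))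
               ≈ a⇒ {A} {B} {C ⊗₀ D} ∘ a⇒ {A ⊗₀ B} {C} {D}
    hexagon  : ∀ {A B C} →
               (id {B} ⊗₁ σ {A} {C}) ∘ (a⇒ {B} {A} {C} ∘ (σ {A} {B} ⊗₁ id {C}))
               ≈ a⇒ {B} {C} {A} ∘ (σ {A} {B ⊗₀ C} ∘ a⇒ {A} {B} {C})
    σ-involutive : ∀ {A B} → σ {B} {A} ∘ σ {A} {B} ≈ id

module _ {o ℓ e : Level} (C : SymmetricMonoidalCategory o ℓ e) where
  open SymmetricMonoidalCategory C

  Scalar : Set ℓ
  Scalar = unit ⇒ unit

  _·_ : ∀ {A B} → Scalar → A ⇒ B → A ⇒ B
  s · f = l⇒ ∘ ((s ⊗₁ f) ∘ l⇐)

  IsInvertibleScalar : Scalar → Set (ℓ ⊔ e)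
  IsInvertibleScalar s = Σ Scalar (λ t → (s ∘ t ≈ id) × (t ∘ s ≈ id))

  NoNontrivialInvertibleScalars : Set (ℓ ⊔ e)
  NoNontrivialInvertibleScalars = (s : Scalar) → IsInvertibleScalar s → s ≈ id

  IsPluggingSet : ∀ {ι} {Ix : Set ι} (Q : Obj) → (Ix → unit ⇒ Q) → Set (o ⊔ ℓ ⊔ e ⊔ ι)
  IsPluggingSet {Ix = Ix} Q ψ =
    ∀ (A : Obj) (f g : Q ⇒ A) → (f ≈ g) ⇔ ((i : Ix) → f ∘ ψ i ≈ g ∘ ψ i)

  pointPair : ∀ {Q} → unit ⇒ Q → unit ⇒ Q → Bool → unit ⇒ Q
  pointPair ψ₁ ψ₂ true  = ψ₁
  pointPair ψ₁ ψ₂ false = ψ₂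

  record CFA (Q : Obj) : Set (ℓ ⊔ e) where
    field
      μ : (Q ⊗₀ Q) ⇒ Q
      η : unit ⇒ Q
      δ : Q ⇒ (Q ⊗₀ Q)
      ε : Q ⇒ unit
      μ-assoc : μ ∘ (μ ⊗₁ id) ≈ μ ∘ ((id ⊗₁ μ) ∘ a⇒)
      μ-unitˡ : μ ∘ (η ⊗₁ id) ≈ l⇒
      μ-unitʳ : μ ∘ (id ⊗₁ η) ≈ r⇒
      μ-comm  : μ ∘ σ ≈ μ
      δ-coassoc : (δ ⊗₁ id) ∘ δ ≈ a⇐ ∘ ((id ⊗₁ δ) ∘ δ)
      δ-counitˡ : (ε ⊗₁ id) ∘ δ ≈ l⇐
      δ-counitʳ : (id ⊗₁ ε) ∘ δ ≈ r⇐
      δ-cocomm  : σ ∘ δ ≈ δ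
      frobeniusˡ : (id ⊗₁ μ) ∘ (a⇒ ∘ (δ ⊗₁ id)) ≈ δ ∘ μ
      frobeniusʳ : (μ ⊗₁ id) ∘ (a⇐ ∘ (id ⊗₁ δ)) ≈ δ ∘ μ

  module _ {Q : Obj} where
    IsSpecial : CFA Q → Set e
    IsSpecial F = μ ∘ δ ≈ id
      where open CFA F

    loopScalar : CFA Q → Scalar
    loopScalar F = ε ∘ (μ ∘ (δ ∘ η))
      where open CFA F

    IsAntiSpecial : CFA Q → Set e
    IsAntiSpecial F = loopScalar F · (μ ∘ δ) ≈ (μ ∘ (δ ∘ η)) ∘ (ε ∘ (μ ∘ δ))
      where open CFA F

    τ : (ghz w : CFA Q) → Q ⇒ Q
    τ ghz w = l⇒ ∘ (((CFA.ε w ∘ CFA.μ w) ⊗₁ id) ∘ (a⇐ ∘ ((id ⊗₁ (CFA.δ ghz ∘ CFA.η ghz)) ∘ r⇐)))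

    -- GHZ/W-pair: ghz = (μ∘,η∘,δ∘,ε∘) special, w = (μ•,η•,δ•,ε•) anti-special
    record IsGHZWPair (ghz w : CFA Q) : Set e where
      private
        module G = CFA ghz
        module W = CFA w
      field
        ghz-special    : IsSpecial ghz
        w-antiSpecial  : IsAntiSpecial w
        pair-α : τ ghz w ≈ l⇒ ∘ (((G.ε ∘ G.μ) ⊗₁ id) ∘ (a⇐ ∘ ((id ⊗₁ (W.δ ∘ W.η)) ∘ r⇐)))
        pair-β : G.δ ∘ W.η ≈ (W.η ⊗₁ W.η) ∘ l⇐
        pair-γ : G.δ ∘ τ ghz w ≈ (τ ghz w ⊗₁ τ ghz w) ∘ G.δ
        pair-ξ : loopScalar w · (τ ghz w ∘ W.η) ≈ W.μ ∘ (W.δ ∘ W.η)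

{-# OPTIONS --safe #-}
module Submission where

-- Scalars act on points by precomposition.  A copyable point x satisfies × x = x ∘ s for some
-- scalar s; both 0 := η• and ∞ := τ ∘ η• are copyable, and × 0 = 0 ∘ k.  Evaluating on 0 and ∞
-- in either slot shows × (x + y) = (× x + × y) ∘ k, where + is μ•.  The case x = y = ∞ uses that
-- τ exchanges the pairings ε∘ ∘ μ∘ and ε• ∘ μ•.  Commutativity then makes ψ + × ψ an eigenvector
-- of × for the eigenvalue k, and the pairing ε∘ ∘ μ∘ against η∘ and × ∘ η∘ determines such an
-- eigenvector as a multiple of 0.

open import Defs
open import Data.Bool using (Bool; true; false)
open import Function.Bundles using (Equivalence)
open import Relation.Binary using (Setoid; IsEquivalence)
import Relation.Binary.Reasoning.Setoid as SetoidReasoning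

-- Equational reasoning in a symmetric monoidal category.

module MonoidalLemmas {o ℓ e} (C : SymmetricMonoidalCategory o ℓ e) where
  open SymmetricMonoidalCategory C

  private variable
    A B D E X Y Z : Obj

  hom : Obj → Obj → Setoid ℓ e
  hom A B = record { Carrier = A ⇒ B ; _≈_ = _≈_ ; isEquivalence = ≈-equiv }

  open module HomReasoning {A B} = SetoidReasoning (hom A B) public

  ≈-refl : {f : A ⇒ B} → f ≈ f
  ≈-refl = IsEquivalence.refl ≈-equiv

  ≈-sym : {f g : A ⇒ B} → f ≈ g → g ≈ f
  ≈-sym = IsEquivalence.sym ≈-equiv

  ≈-trans : {f g h : A ⇒ B} → f ≈ g → g ≈ h → f ≈ h
  ≈-trans = IsEquivalence.trans ≈-equiv

  infixr 4 refl⟩∘⟨_ refl⟩⊗⟨_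
  infixl 4 _⟩∘⟨refl _⟩⊗⟨refl

  refl⟩∘⟨_ : {f : B ⇒ D} {g h : A ⇒ B} → g ≈ h → f ∘ g ≈ f ∘ h
  refl⟩∘⟨ p = ∘-resp-≈ ≈-refl p

  _⟩∘⟨refl : {f g : B ⇒ D} {h : A ⇒ B} → f ≈ g → f ∘ h ≈ g ∘ h
  p ⟩∘⟨refl = ∘-resp-≈ p ≈-refl

  refl⟩⊗⟨_ : {f : A ⇒ B} {g h : D ⇒ E} → g ≈ h → f ⊗₁ g ≈ f ⊗₁ h
  refl⟩⊗⟨ p = ⊗-resp-≈ ≈-refl p

  _⟩⊗⟨refl : {f g : A ⇒ B} {h : D ⇒ E} → f ≈ g → f ⊗₁ h ≈ g ⊗₁ h
  p ⟩⊗⟨refl = ⊗-resp-≈ p ≈-refl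

  pullˡ : {f : A ⇒ B} {g : B ⇒ D} {h : D ⇒ E} {i : B ⇒ E} → h ∘ g ≈ i → h ∘ (g ∘ f) ≈ i ∘ f
  pullˡ p = ≈-trans (≈-sym assoc) (p ⟩∘⟨refl)

  pullʳ : {f : A ⇒ B} {g : B ⇒ D} {h : D ⇒ E} {i : A ⇒ D} → g ∘ f ≈ i → (h ∘ g) ∘ f ≈ h ∘ i
  pullʳ p = ≈-trans assoc (refl⟩∘⟨ p)

  extendʳ : {f : A ⇒ B} {g : B ⇒ D} {h : D ⇒ E} {i : B ⇒ X} {j : X ⇒ E} →
            h ∘ g ≈ j ∘ i → h ∘ (g ∘ f) ≈ j ∘ (i ∘ f)
  extendʳ p = ≈-trans (pullˡ p) assoc

  cancelˡ : {f : A ⇒ B} {g : B ⇒ D} {h : D ⇒ B} → h ∘ g ≈ id → h ∘ (g ∘ f) ≈ f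
  cancelˡ p = ≈-trans (pullˡ p) identityˡ

  cancelʳ : {f : A ⇒ B} {g : B ⇒ A} {h : B ⇒ D} → f ∘ g ≈ id → (h ∘ f) ∘ g ≈ h
  cancelʳ p = ≈-trans (pullʳ p) identityʳ

  retract⇒epi : {f g : B ⇒ D} {p : A ⇒ B} {q : B ⇒ A} → p ∘ q ≈ id → f ∘ p ≈ g ∘ p → f ≈ g
  retract⇒epi pq eq = ≈-trans (≈-sym (cancelʳ pq)) (≈-trans (eq ⟩∘⟨refl) (cancelʳ pq))

  retract⇒mono : {f g : A ⇒ B} {p : B ⇒ D} {q : D ⇒ B} → q ∘ p ≈ id → p ∘ f ≈ p ∘ g → f ≈ g
  retract⇒mono qp eq = ≈-trans (≈-sym (cancelˡ qp)) (≈-trans (refl⟩∘⟨ eq) (cancelˡ qp))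

  merge : {f : A ⇒ B} {g : B ⇒ D} {h : X ⇒ Y} {k : Y ⇒ Z} → (g ⊗₁ k) ∘ (f ⊗₁ h) ≈ (g ∘ f) ⊗₁ (k ∘ h)
  merge = ≈-sym ⊗-homomorphism

  mergeˡ : {f : A ⇒ B} {g : B ⇒ D} → (g ⊗₁ id {X}) ∘ (f ⊗₁ id) ≈ (g ∘ f) ⊗₁ id
  mergeˡ = ≈-trans merge (refl⟩⊗⟨ identityˡ)

  mergeʳ : {f : A ⇒ B} {g : B ⇒ D} → (id {X} ⊗₁ g) ∘ (id ⊗₁ f) ≈ id ⊗₁ (g ∘ f)
  mergeʳ = ≈-trans merge (identityˡ ⟩⊗⟨refl)

  split₁₂ : {f : A ⇒ B} {g : D ⇒ E} → (f ⊗₁ id) ∘ (id ⊗₁ g) ≈ f ⊗₁ g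
  split₁₂ = ≈-trans merge (⊗-resp-≈ identityʳ identityˡ)

  split₂₁ : {f : A ⇒ B} {g : D ⇒ E} → (id ⊗₁ g) ∘ (f ⊗₁ id) ≈ f ⊗₁ g
  split₂₁ = ≈-trans merge (⊗-resp-≈ identityˡ identityʳ)

  interchange : {f : A ⇒ B} {g : D ⇒ E} → (f ⊗₁ id) ∘ (id ⊗₁ g) ≈ (id ⊗₁ g) ∘ (f ⊗₁ id)
  interchange = ≈-trans split₁₂ (≈-sym split₂₁)

  -- Coherence of unitors, associator and symmetry.

  ⊗id-inverse : {f : A ⇒ B} {g : B ⇒ A} → f ∘ g ≈ id → (f ⊗₁ id {X}) ∘ (g ⊗₁ id) ≈ id
  ⊗id-inverse p = ≈-trans mergeˡ (≈-trans (p ⟩⊗⟨refl) ⊗-identity)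

  -- Naturality of `l⇒` makes `id ⊗₁ f` a conjugate of `f`. The coherence equations below are
  -- checked after such a tensoring with the unit, where triangle, pentagon and hexagon apply.
  id⊗-faithful : {f g : A ⇒ B} → id {unit} ⊗₁ f ≈ id ⊗₁ g → f ≈ g
  id⊗-faithful p = retract⇒epi l-isoʳ
    (≈-trans (≈-sym l-natural) (≈-trans (refl⟩∘⟨ p) l-natural))

  ⊗id-faithful : {f g : A ⇒ B} → f ⊗₁ id {unit} ≈ g ⊗₁ id → f ≈ g
  ⊗id-faithful p = retract⇒epi r-isoʳ
    (≈-trans (≈-sym r-natural) (≈-trans (refl⟩∘⟨ p) r-natural))

  l⇐-natural : {f : A ⇒ B} → (id ⊗₁ f) ∘ l⇐ ≈ l⇐ ∘ f
  l⇐-natural {f = f} = retract⇒mono l-isoˡ (begin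
    l⇒ ∘ ((id ⊗₁ f) ∘ l⇐) ≈⟨ extendʳ l-natural ⟩
    f ∘ (l⇒ ∘ l⇐)         ≈⟨ refl⟩∘⟨ l-isoʳ ⟩
    f ∘ id                ≈⟨ identityʳ ⟩
    f                     ≈⟨ cancelˡ l-isoʳ ⟨
    l⇒ ∘ (l⇐ ∘ f)         ∎)

  r⇐-natural : {f : A ⇒ B} → (f ⊗₁ id) ∘ r⇐ ≈ r⇐ ∘ f
  r⇐-natural {f = f} = retract⇒mono r-isoˡ (begin
    r⇒ ∘ ((f ⊗₁ id) ∘ r⇐) ≈⟨ extendʳ r-natural ⟩
    f ∘ (r⇒ ∘ r⇐)         ≈⟨ refl⟩∘⟨ r-isoʳ ⟩
    f ∘ id                ≈⟨ identityʳ ⟩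
    f                     ≈⟨ cancelˡ r-isoʳ ⟨
    r⇒ ∘ (r⇐ ∘ f)         ∎)

  a⇐-natural : {f : A ⇒ B} {g : D ⇒ E} {h : X ⇒ Y} →
               a⇐ ∘ (f ⊗₁ (g ⊗₁ h)) ≈ ((f ⊗₁ g) ⊗₁ h) ∘ a⇐
  a⇐-natural {f = f} {g} {h} = retract⇒mono a-isoˡ (begin
    a⇒ ∘ (a⇐ ∘ (f ⊗₁ (g ⊗₁ h)))   ≈⟨ cancelˡ a-isoʳ ⟩
    f ⊗₁ (g ⊗₁ h)                 ≈⟨ identityʳ ⟨
    (f ⊗₁ (g ⊗₁ h)) ∘ id          ≈⟨ refl⟩∘⟨ a-isoʳ ⟨
    (f ⊗₁ (g ⊗₁ h)) ∘ (a⇒ ∘ a⇐)   ≈⟨ extendʳ a-natural ⟨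
    a⇒ ∘ (((f ⊗₁ g) ⊗₁ h) ∘ a⇐)   ∎)

  -- Kelly's argument: after tensoring with the unit on the left and precomposing with the
  -- invertible `a⇒ ∘ (a⇒ ⊗₁ id)`, the pentagon and two triangles join the two sides.
  l⇒-a⇒ : l⇒ {A ⊗₀ B} ∘ a⇒ ≈ l⇒ ⊗₁ id
  l⇒-a⇒ = id⊗-faithful (retract⇒epi a-isoʳ (retract⇒epi (⊗id-inverse a-isoʳ) (begin
    ((id ⊗₁ (l⇒ ∘ a⇒)) ∘ a⇒) ∘ (a⇒ ⊗₁ id)         ≈⟨ assoc ⟩
    (id ⊗₁ (l⇒ ∘ a⇒)) ∘ (a⇒ ∘ (a⇒ ⊗₁ id))         ≈⟨ mergeʳ ⟩∘⟨refl ⟨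
    ((id ⊗₁ l⇒) ∘ (id ⊗₁ a⇒)) ∘ (a⇒ ∘ (a⇒ ⊗₁ id)) ≈⟨ pullʳ pentagon ⟩
    (id ⊗₁ l⇒) ∘ (a⇒ ∘ a⇒)                         ≈⟨ pullˡ triangle ⟩
    (r⇒ ⊗₁ id) ∘ a⇒                                ≈⟨ (refl⟩⊗⟨ ⊗-identity) ⟩∘⟨refl ⟨
    (r⇒ ⊗₁ (id ⊗₁ id)) ∘ a⇒                        ≈⟨ a-natural ⟨
    a⇒ ∘ ((r⇒ ⊗₁ id) ⊗₁ id)                        ≈⟨ refl⟩∘⟨ (triangle ⟩⊗⟨refl) ⟨
    a⇒ ∘ (((id ⊗₁ l⇒) ∘ a⇒) ⊗₁ id)                 ≈⟨ refl⟩∘⟨ mergeˡ ⟨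
    a⇒ ∘ (((id ⊗₁ l⇒) ⊗₁ id) ∘ (a⇒ ⊗₁ id))         ≈⟨ extendʳ a-natural ⟩
    (id ⊗₁ (l⇒ ⊗₁ id)) ∘ (a⇒ ∘ (a⇒ ⊗₁ id))         ≈⟨ assoc ⟨
    ((id ⊗₁ (l⇒ ⊗₁ id)) ∘ a⇒) ∘ (a⇒ ⊗₁ id)         ∎)))

  id⊗r⇒-a⇒ : (id {A} ⊗₁ r⇒ {B}) ∘ a⇒ ≈ r⇒
  id⊗r⇒-a⇒ = ⊗id-faithful (retract⇒mono a-isoˡ (begin
    a⇒ ∘ (((id ⊗₁ r⇒) ∘ a⇒) ⊗₁ id)                         ≈⟨ refl⟩∘⟨ mergeˡ ⟨
    a⇒ ∘ (((id ⊗₁ r⇒) ⊗₁ id) ∘ (a⇒ ⊗₁ id))                 ≈⟨ extendʳ a-natural ⟩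
    (id ⊗₁ (r⇒ ⊗₁ id)) ∘ (a⇒ ∘ (a⇒ ⊗₁ id))                 ≈⟨ (refl⟩⊗⟨ triangle) ⟩∘⟨refl ⟨
    (id ⊗₁ ((id ⊗₁ l⇒) ∘ a⇒)) ∘ (a⇒ ∘ (a⇒ ⊗₁ id))          ≈⟨ mergeʳ ⟩∘⟨refl ⟨
    ((id ⊗₁ (id ⊗₁ l⇒)) ∘ (id ⊗₁ a⇒)) ∘ (a⇒ ∘ (a⇒ ⊗₁ id))  ≈⟨ pullʳ pentagon ⟩
    (id ⊗₁ (id ⊗₁ l⇒)) ∘ (a⇒ ∘ a⇒)                          ≈⟨ extendʳ a-natural ⟨
    a⇒ ∘ (((id ⊗₁ id) ⊗₁ l⇒) ∘ a⇒)                          ≈⟨ refl⟩∘⟨ (⊗-identity ⟩⊗⟨refl ⟩∘⟨refl) ⟩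
    a⇒ ∘ ((id ⊗₁ l⇒) ∘ a⇒)                                  ≈⟨ refl⟩∘⟨ triangle ⟩
    a⇒ ∘ (r⇒ ⊗₁ id)                                         ∎))

  r⇒-a⇐ : r⇒ ∘ a⇐ ≈ id {A} ⊗₁ r⇒ {B}
  r⇒-a⇐ = retract⇒epi a-isoʳ
    (≈-trans (cancelʳ a-isoˡ) (≈-sym id⊗r⇒-a⇒))

  a⇒-r⇐ : a⇒ ∘ (r⇐ {A} ⊗₁ id {B}) ≈ id ⊗₁ l⇐
  a⇒-r⇐ = retract⇒epi (⊗id-inverse r-isoʳ) (begin
    (a⇒ ∘ (r⇐ ⊗₁ id)) ∘ (r⇒ ⊗₁ id)           ≈⟨ cancelʳ (⊗id-inverse r-isoˡ) ⟩
    a⇒                                        ≈⟨ identityˡ ⟨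
    id ∘ a⇒                                   ≈⟨ ≈-trans (refl⟩⊗⟨ l-isoˡ) ⊗-identity ⟩∘⟨refl ⟨
    (id ⊗₁ (l⇐ ∘ l⇒)) ∘ a⇒                    ≈⟨ mergeʳ ⟩∘⟨refl ⟨
    ((id ⊗₁ l⇐) ∘ (id ⊗₁ l⇒)) ∘ a⇒            ≈⟨ pullʳ triangle ⟩
    (id ⊗₁ l⇐) ∘ (r⇒ ⊗₁ id)                   ∎)

  l⇒≈r⇒ : l⇒ {unit} ≈ r⇒
  l⇒≈r⇒ = ⊗id-faithful (begin
    l⇒ ⊗₁ id          ≈⟨ l⇒-a⇒ ⟨
    -- Naturality of `l⇒` at `l⇒` itself, with the outer `l⇒` cancelled, gives `id ⊗₁ l⇒ ≈ l⇒`.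
    l⇒ ∘ a⇒           ≈⟨ retract⇒mono l-isoˡ l-natural ⟩∘⟨refl ⟨
    (id ⊗₁ l⇒) ∘ a⇒   ≈⟨ triangle ⟩
    r⇒ ⊗₁ id          ∎)

  l⇐≈r⇐ : l⇐ {unit} ≈ r⇐
  l⇐≈r⇐ = retract⇒mono l-isoˡ (≈-trans l-isoʳ (≈-sym (≈-trans (l⇒≈r⇒ ⟩∘⟨refl) r-isoʳ)))

  -- The map `l⇒ ∘ σ` is invertible, so it may be postcomposed to both sides and cancelled. The
  -- hexagon with two unit factors then relates the results.
  l⇒-σ : l⇒ ∘ σ ≈ r⇒ {A}
  l⇒-σ = ⊗id-faithful (retract⇒mono {q = σ ∘ l⇐} (≈-trans (pullʳ (cancelˡ l-isoˡ)) σ-involutive) (begin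
    (l⇒ ∘ σ) ∘ ((l⇒ ∘ σ) ⊗₁ id)                   ≈⟨ refl⟩∘⟨ mergeˡ ⟨
    (l⇒ ∘ σ) ∘ ((l⇒ ⊗₁ id) ∘ (σ ⊗₁ id))           ≈⟨ refl⟩∘⟨ (l⇒-a⇒ ⟩∘⟨refl) ⟨
    (l⇒ ∘ σ) ∘ ((l⇒ ∘ a⇒) ∘ (σ ⊗₁ id))            ≈⟨ refl⟩∘⟨ assoc ⟩
    (l⇒ ∘ σ) ∘ (l⇒ ∘ (a⇒ ∘ (σ ⊗₁ id)))            ≈⟨ extendʳ l-natural ⟨
    l⇒ ∘ ((id ⊗₁ (l⇒ ∘ σ)) ∘ (a⇒ ∘ (σ ⊗₁ id)))    ≈⟨ refl⟩∘⟨ (mergeʳ ⟩∘⟨refl) ⟨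
    l⇒ ∘ (((id ⊗₁ l⇒) ∘ (id ⊗₁ σ)) ∘ (a⇒ ∘ (σ ⊗₁ id))) ≈⟨ refl⟩∘⟨ pullʳ hexagon ⟩
    l⇒ ∘ ((id ⊗₁ l⇒) ∘ (a⇒ ∘ (σ ∘ a⇒)))           ≈⟨ refl⟩∘⟨ pullˡ triangle ⟩
    l⇒ ∘ ((r⇒ ⊗₁ id) ∘ (σ ∘ a⇒))                  ≈⟨ refl⟩∘⟨ extendʳ σ-natural ⟨
    l⇒ ∘ (σ ∘ ((id ⊗₁ r⇒) ∘ a⇒))                  ≈⟨ refl⟩∘⟨ refl⟩∘⟨ ((refl⟩⊗⟨ l⇒≈r⇒) ⟩∘⟨refl) ⟨
    l⇒ ∘ (σ ∘ ((id ⊗₁ l⇒) ∘ a⇒))                  ≈⟨ refl⟩∘⟨ refl⟩∘⟨ triangle ⟩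
    l⇒ ∘ (σ ∘ (r⇒ ⊗₁ id))                         ≈⟨ assoc ⟨
    (l⇒ ∘ σ) ∘ (r⇒ ⊗₁ id)                         ∎))

  σ-l⇐ : σ ∘ l⇐ {unit} ≈ l⇐
  σ-l⇐ = retract⇒mono l-isoˡ (begin
    l⇒ ∘ (σ ∘ l⇐) ≈⟨ pullˡ l⇒-σ ⟩
    r⇒ ∘ l⇐       ≈⟨ l⇒≈r⇒ ⟩∘⟨refl ⟨
    l⇒ ∘ l⇐       ∎)

  -- Points, pairs of points and scalars.

  infix 11 ⟨_,_⟩

  -- With `l⇐` in this position, the right side of `pair-β` and the argument of `μ` in the theorem
  -- are such pairs by definition.
  ⟨_,_⟩ : unit ⇒ A → unit ⇒ B → unit ⇒ (A ⊗₀ B)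
  ⟨ x , y ⟩ = (x ⊗₁ y) ∘ l⇐

  ⟨,⟩-cong : {x x′ : unit ⇒ A} {y y′ : unit ⇒ B} → x ≈ x′ → y ≈ y′ → ⟨ x , y ⟩ ≈ ⟨ x′ , y′ ⟩
  ⟨,⟩-cong p q = ⊗-resp-≈ p q ⟩∘⟨refl

  ⊗-⟨,⟩ : {f : A ⇒ B} {g : D ⇒ E} {x : unit ⇒ A} {y : unit ⇒ D} →
          (f ⊗₁ g) ∘ ⟨ x , y ⟩ ≈ ⟨ f ∘ x , g ∘ y ⟩
  ⊗-⟨,⟩ = pullˡ merge

  ⟨,⟩-scalarʳ : {x : unit ⇒ A} {y : unit ⇒ B} {s : unit ⇒ unit} → ⟨ x , y ∘ s ⟩ ≈ ⟨ x , y ⟩ ∘ s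
  ⟨,⟩-scalarʳ {x = x} {y} {s} = begin
    (x ⊗₁ (y ∘ s)) ∘ l⇐          ≈⟨ ≈-trans merge (identityʳ ⟩⊗⟨refl) ⟩∘⟨refl ⟨
    ((x ⊗₁ y) ∘ (id ⊗₁ s)) ∘ l⇐  ≈⟨ pullʳ l⇐-natural ⟩
    (x ⊗₁ y) ∘ (l⇐ ∘ s)          ≈⟨ assoc ⟨
    ⟨ x , y ⟩ ∘ s                ∎

  ⟨,⟩-σ : {x : unit ⇒ A} {y : unit ⇒ B} → σ ∘ ⟨ x , y ⟩ ≈ ⟨ y , x ⟩
  ⟨,⟩-σ = ≈-trans (extendʳ σ-natural) (refl⟩∘⟨ σ-l⇐)

  ⟨,⟩-scalarˡ : {x : unit ⇒ A} {y : unit ⇒ B} {s : unit ⇒ unit} → ⟨ x ∘ s , y ⟩ ≈ ⟨ x , y ⟩ ∘ s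
  ⟨,⟩-scalarˡ {x = x} {y} {s} = begin
    ⟨ x ∘ s , y ⟩        ≈⟨ ⟨,⟩-σ ⟨
    σ ∘ ⟨ y , x ∘ s ⟩    ≈⟨ refl⟩∘⟨ ⟨,⟩-scalarʳ ⟩
    σ ∘ (⟨ y , x ⟩ ∘ s)  ≈⟨ pullˡ ⟨,⟩-σ ⟩
    ⟨ x , y ⟩ ∘ s        ∎

  -- The left side is `s · x` by definition, so this is the bridge between scaling a point and
  -- precomposing it with a scalar.
  l⇒-⟨,⟩ : {s : unit ⇒ unit} {x : unit ⇒ A} → l⇒ ∘ ⟨ s , x ⟩ ≈ x ∘ s
  l⇒-⟨,⟩ {s = s} {x} = begin
    l⇒ ∘ ⟨ s , x ⟩         ≈⟨ refl⟩∘⟨ ⟨,⟩-cong identityˡ ≈-refl ⟨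
    l⇒ ∘ ⟨ id ∘ s , x ⟩    ≈⟨ refl⟩∘⟨ ⟨,⟩-scalarˡ ⟩
    l⇒ ∘ (⟨ id , x ⟩ ∘ s)  ≈⟨ pullˡ (refl⟩∘⟨ l⇐-natural) ⟩
    (l⇒ ∘ (l⇐ ∘ x)) ∘ s    ≈⟨ cancelˡ l-isoʳ ⟩∘⟨refl ⟩
    x ∘ s                  ∎

  -- `σ` swaps the pair and exchanges the unitors, which agree on the unit object.
  scalar-comm : {s t : unit ⇒ unit} → s ∘ t ≈ t ∘ s
  scalar-comm {s} {t} = begin
    s ∘ t                ≈⟨ l⇒-⟨,⟩ ⟨
    l⇒ ∘ ⟨ t , s ⟩       ≈⟨ l⇒≈r⇒ ⟩∘⟨refl ⟩
    r⇒ ∘ ⟨ t , s ⟩       ≈⟨ pullˡ l⇒-σ ⟨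
    l⇒ ∘ (σ ∘ ⟨ t , s ⟩) ≈⟨ refl⟩∘⟨ ⟨,⟩-σ ⟩
    l⇒ ∘ ⟨ s , t ⟩       ≈⟨ l⇒-⟨,⟩ ⟩
    t ∘ s                ∎

  -- Turns a pair with fixed second entry into a morphism of the first, so that plugging sets can be
  -- applied to it.
  _⊗point_ : ∀ X (y : unit ⇒ A) → X ⇒ (X ⊗₀ A)
  X ⊗point y = (id ⊗₁ y) ∘ r⇐

  ⊗point-∘ : {y : unit ⇒ A} {x : unit ⇒ X} → (X ⊗point y) ∘ x ≈ ⟨ x , y ⟩
  ⊗point-∘ {y = y} {x} = begin
    ((id ⊗₁ y) ∘ r⇐) ∘ x          ≈⟨ pullʳ (≈-sym r⇐-natural) ⟩
    (id ⊗₁ y) ∘ ((x ⊗₁ id) ∘ r⇐)  ≈⟨ pullˡ split₂₁ ⟩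
    (x ⊗₁ y) ∘ r⇐                 ≈⟨ refl⟩∘⟨ l⇐≈r⇐ ⟨
    ⟨ x , y ⟩                     ∎

  -- Self-duality of a commutative Frobenius algebra.

  module FrobeniusLemmas {Q : Obj} (F : CFA C Q) where
    open CFA F

    cap : (Q ⊗₀ Q) ⇒ unit
    cap = ε ∘ μ

    cup : unit ⇒ (Q ⊗₀ Q)
    cup = δ ∘ η

    -- `τ` is by definition the transpose, over the GHZ algebra, of the cap of the W algebra. The
    -- right side of `pair-α` is the same with the algebras exchanged.
    transpose : ((Q ⊗₀ Q) ⇒ unit) → Q ⇒ Q
    transpose f = l⇒ ∘ ((f ⊗₁ id) ∘ (a⇐ ∘ ((id ⊗₁ cup) ∘ r⇐)))

    μ-unitˡ′ : μ ∘ ((η ⊗₁ id) ∘ l⇐) ≈ id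
    μ-unitˡ′ = ≈-trans (pullˡ μ-unitˡ) l-isoʳ

    μ-unit-⟨,⟩ : {x : unit ⇒ Q} → μ ∘ ⟨ η , x ⟩ ≈ x
    μ-unit-⟨,⟩ {x} = begin
      μ ∘ ⟨ η , x ⟩                   ≈⟨ refl⟩∘⟨ pullˡ split₁₂ ⟨
      μ ∘ ((η ⊗₁ id) ∘ ((id ⊗₁ x) ∘ l⇐)) ≈⟨ pullˡ μ-unitˡ ⟩
      l⇒ ∘ ((id ⊗₁ x) ∘ l⇐)           ≈⟨ refl⟩∘⟨ l⇐-natural ⟩
      l⇒ ∘ (l⇐ ∘ x)                   ≈⟨ cancelˡ l-isoʳ ⟩
      x                               ∎

    μ-comm-⟨,⟩ : {x y : unit ⇒ Q} → μ ∘ ⟨ x , y ⟩ ≈ μ ∘ ⟨ y , x ⟩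
    μ-comm-⟨,⟩ = ≈-trans (≈-sym (pullˡ μ-comm)) (refl⟩∘⟨ ⟨,⟩-σ)

    -- The Frobenius law rewrites the zigzag as `δ ∘ μ`; the unit and counit laws then remove both
    -- factors.
    snake : r⇒ ∘ ((id ⊗₁ cap) ∘ (a⇒ ∘ ((cup ⊗₁ id) ∘ l⇐))) ≈ id
    snake = begin
      r⇒ ∘ ((id ⊗₁ cap) ∘ (a⇒ ∘ ((cup ⊗₁ id) ∘ l⇐)))
        ≈⟨ refl⟩∘⟨ ∘-resp-≈ (≈-sym mergeʳ) (refl⟩∘⟨ (≈-sym mergeˡ ⟩∘⟨refl)) ⟩
      r⇒ ∘ (((id ⊗₁ ε) ∘ (id ⊗₁ μ)) ∘ (a⇒ ∘ (((δ ⊗₁ id) ∘ (η ⊗₁ id)) ∘ l⇐)))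
        ≈⟨ refl⟩∘⟨ pullʳ (refl⟩∘⟨ ≈-trans (refl⟩∘⟨ assoc) (≈-sym assoc)) ⟩
      r⇒ ∘ ((id ⊗₁ ε) ∘ ((id ⊗₁ μ) ∘ ((a⇒ ∘ (δ ⊗₁ id)) ∘ ((η ⊗₁ id) ∘ l⇐))))
        ≈⟨ refl⟩∘⟨ refl⟩∘⟨ extendʳ frobeniusˡ ⟩
      r⇒ ∘ ((id ⊗₁ ε) ∘ (δ ∘ (μ ∘ ((η ⊗₁ id) ∘ l⇐))))
        ≈⟨ refl⟩∘⟨ refl⟩∘⟨ refl⟩∘⟨ μ-unitˡ′ ⟩
      r⇒ ∘ ((id ⊗₁ ε) ∘ (δ ∘ id))
        ≈⟨ refl⟩∘⟨ ≈-trans (refl⟩∘⟨ identityʳ) δ-counitʳ ⟩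
      r⇒ ∘ r⇐
        ≈⟨ r-isoʳ ⟩
      id ∎

    -- `cap` and `f` act on different legs of the `cup`, so `f` can be pulled to the outside. A
    -- zigzag on its second input remains, and `snake` straightens it.
    cap-transpose : (f : (Q ⊗₀ Q) ⇒ unit) → cap ∘ (transpose f ⊗₁ id) ≈ f
    cap-transpose f = begin
      cap ∘ (transpose f ⊗₁ id)
        ≈⟨ refl⟩∘⟨ ≈-trans (refl⟩∘⟨ ≈-trans (refl⟩∘⟨ ≈-trans (refl⟩∘⟨ mergeˡ) mergeˡ) mergeˡ) mergeˡ ⟨
      cap ∘ ((l⇒ ⊗₁ id) ∘ (((f ⊗₁ id) ⊗₁ id) ∘ ((a⇐ ⊗₁ id) ∘ (((id ⊗₁ cup) ⊗₁ id) ∘ (r⇐ ⊗₁ id)))))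
        ≈⟨ refl⟩∘⟨ ≈-trans (≈-sym l⇒-a⇒ ⟩∘⟨refl) (pullʳ (extendʳ a-natural)) ⟩
      cap ∘ (l⇒ ∘ ((f ⊗₁ (id ⊗₁ id)) ∘ (a⇒ ∘ ((a⇐ ⊗₁ id) ∘ (((id ⊗₁ cup) ⊗₁ id) ∘ (r⇐ ⊗₁ id))))))
        ≈⟨ extendʳ (≈-sym l-natural) ⟩
      l⇒ ∘ ((id ⊗₁ cap) ∘ ((f ⊗₁ (id ⊗₁ id)) ∘ (a⇒ ∘ ((a⇐ ⊗₁ id) ∘ (((id ⊗₁ cup) ⊗₁ id) ∘ (r⇐ ⊗₁ id))))))
        ≈⟨ refl⟩∘⟨ extendʳ (≈-trans (refl⟩∘⟨ refl⟩⊗⟨ ⊗-identity) (≈-sym interchange)) ⟩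
      l⇒ ∘ ((f ⊗₁ id) ∘ ((id ⊗₁ cap) ∘ (a⇒ ∘ ((a⇐ ⊗₁ id) ∘ (((id ⊗₁ cup) ⊗₁ id) ∘ (r⇐ ⊗₁ id))))))
        ≈⟨ extendʳ (≈-trans (l⇒≈r⇒ ⟩∘⟨refl) r-natural) ⟩
      f ∘ (r⇒ ∘ ((id ⊗₁ cap) ∘ (a⇒ ∘ ((a⇐ ⊗₁ id) ∘ (((id ⊗₁ cup) ⊗₁ id) ∘ (r⇐ ⊗₁ id))))))
        -- From here the part inside `f` is reassociated until its first leg is a bare `id` and the
        -- zigzag lies in the second. `a⇒-a⇐` is the pentagon with one associator inverted.
        ≈⟨ refl⟩∘⟨ refl⟩∘⟨ ∘-resp-≈ (≈-sym ⊗-identity ⟩⊗⟨refl)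
             (≈-trans (pullˡ a⇒-a⇐) (≈-trans assoc (refl⟩∘⟨ ≈-trans assoc (refl⟩∘⟨ extendʳ a-natural)))) ⟩
      f ∘ (r⇒ ∘ (((id ⊗₁ id) ⊗₁ cap) ∘ (a⇐ ∘ ((id ⊗₁ a⇒) ∘ ((id ⊗₁ (cup ⊗₁ id)) ∘ (a⇒ ∘ (r⇐ ⊗₁ id)))))))
        ≈⟨ refl⟩∘⟨ refl⟩∘⟨ extendʳ (≈-sym a⇐-natural) ⟩
      f ∘ (r⇒ ∘ (a⇐ ∘ ((id ⊗₁ (id ⊗₁ cap)) ∘ ((id ⊗₁ a⇒) ∘ ((id ⊗₁ (cup ⊗₁ id)) ∘ (a⇒ ∘ (r⇐ ⊗₁ id)))))))
        ≈⟨ refl⟩∘⟨ ≈-trans (pullˡ r⇒-a⇐) (refl⟩∘⟨ refl⟩∘⟨ refl⟩∘⟨ refl⟩∘⟨ a⇒-r⇐) ⟩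
      f ∘ ((id ⊗₁ r⇒) ∘ ((id ⊗₁ (id ⊗₁ cap)) ∘ ((id ⊗₁ a⇒) ∘ ((id ⊗₁ (cup ⊗₁ id)) ∘ (id ⊗₁ l⇐)))))
        ≈⟨ refl⟩∘⟨ ≈-trans (refl⟩∘⟨ ≈-trans (refl⟩∘⟨ ≈-trans (refl⟩∘⟨ mergeʳ) mergeʳ) mergeʳ) mergeʳ ⟩
      f ∘ (id ⊗₁ (r⇒ ∘ ((id ⊗₁ cap) ∘ (a⇒ ∘ ((cup ⊗₁ id) ∘ l⇐)))))
        ≈⟨ refl⟩∘⟨ ≈-trans (refl⟩⊗⟨ snake) ⊗-identity ⟩
      f ∘ id
        ≈⟨ identityʳ ⟩
      f ∎
      where
      a⇒-a⇐ : ∀ {A B D E} → a⇒ ∘ (a⇐ {A} {B} {D} ⊗₁ id {E}) ≈ a⇐ ∘ ((id ⊗₁ a⇒) ∘ a⇒)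
      a⇒-a⇐ = retract⇒mono a-isoˡ (retract⇒epi (⊗id-inverse a-isoʳ) (begin
        (a⇒ ∘ (a⇒ ∘ (a⇐ ⊗₁ id))) ∘ (a⇒ ⊗₁ id)         ≈⟨ pullʳ (cancelʳ (⊗id-inverse a-isoˡ)) ⟩
        a⇒ ∘ a⇒                                       ≈⟨ pentagon ⟨
        (id ⊗₁ a⇒) ∘ (a⇒ ∘ (a⇒ ⊗₁ id))                ≈⟨ assoc ⟨
        ((id ⊗₁ a⇒) ∘ a⇒) ∘ (a⇒ ⊗₁ id)                ≈⟨ cancelˡ a-isoʳ ⟩∘⟨refl ⟨
        (a⇒ ∘ (a⇐ ∘ ((id ⊗₁ a⇒) ∘ a⇒))) ∘ (a⇒ ⊗₁ id)  ∎))

    cap-transpose-⟨,⟩ : {t : Q ⇒ Q} {f : (Q ⊗₀ Q) ⇒ unit} → t ≈ transpose f →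
                        {x y : unit ⇒ Q} → cap ∘ ⟨ t ∘ x , y ⟩ ≈ f ∘ ⟨ x , y ⟩
    cap-transpose-⟨,⟩ {t} {f} eq {x} {y} = begin
      cap ∘ ⟨ t ∘ x , y ⟩           ≈⟨ refl⟩∘⟨ ⟨,⟩-cong ≈-refl identityˡ ⟨
      cap ∘ ⟨ t ∘ x , id ∘ y ⟩      ≈⟨ refl⟩∘⟨ ⊗-⟨,⟩ ⟨
      cap ∘ ((t ⊗₁ id) ∘ ⟨ x , y ⟩) ≈⟨ pullˡ (≈-trans (refl⟩∘⟨ (eq ⟩⊗⟨refl)) (cap-transpose f)) ⟩
      f ∘ ⟨ x , y ⟩                 ∎

    -- Nondegeneracy of `cap`: `snake` applied to `x` rebuilds the point from the functional that
    -- pairs with it.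
    point-from-functional : (x : unit ⇒ Q) →
      x ≈ r⇒ ∘ ((id ⊗₁ ((cap ∘ (Q ⊗point x)) ∘ r⇒)) ∘ (a⇒ ∘ ((cup ⊗₁ id) ∘ l⇐)))
    point-from-functional x = begin
      x
        ≈⟨ identityˡ ⟨
      id ∘ x
        ≈⟨ snake ⟩∘⟨refl ⟨
      (r⇒ ∘ ((id ⊗₁ cap) ∘ (a⇒ ∘ ((cup ⊗₁ id) ∘ l⇐)))) ∘ x
        ≈⟨ pullʳ (pullʳ (pullʳ (pullʳ (≈-sym l⇐-natural)))) ⟩
      r⇒ ∘ ((id ⊗₁ cap) ∘ (a⇒ ∘ ((cup ⊗₁ id) ∘ ((id ⊗₁ x) ∘ l⇐))))
        ≈⟨ refl⟩∘⟨ refl⟩∘⟨ refl⟩∘⟨ extendʳ (≈-trans interchange (≈-sym ⊗-identity ⟩⊗⟨refl ⟩∘⟨refl)) ⟩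
      r⇒ ∘ ((id ⊗₁ cap) ∘ (a⇒ ∘ (((id ⊗₁ id) ⊗₁ x) ∘ ((cup ⊗₁ id) ∘ l⇐))))
        ≈⟨ refl⟩∘⟨ refl⟩∘⟨ extendʳ a-natural ⟩
      r⇒ ∘ ((id ⊗₁ cap) ∘ ((id ⊗₁ (id ⊗₁ x)) ∘ (a⇒ ∘ ((cup ⊗₁ id) ∘ l⇐))))
        ≈⟨ refl⟩∘⟨ pullˡ mergeʳ ⟩
      r⇒ ∘ ((id ⊗₁ (cap ∘ (id ⊗₁ x))) ∘ (a⇒ ∘ ((cup ⊗₁ id) ∘ l⇐)))
        ≈⟨ refl⟩∘⟨ ((refl⟩⊗⟨ pullʳ (cancelʳ r-isoˡ)) ⟩∘⟨refl) ⟨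
      r⇒ ∘ ((id ⊗₁ ((cap ∘ (Q ⊗point x)) ∘ r⇒)) ∘ (a⇒ ∘ ((cup ⊗₁ id) ∘ l⇐))) ∎

    -- The plugging set, used with target `unit`, identifies the two functionals, and a point is
    -- recovered from its functional.
    cap-separates : {p q : unit ⇒ Q} → IsPluggingSet C Q (pointPair C p q) → {x y : unit ⇒ Q} →
                    cap ∘ ⟨ p , x ⟩ ≈ cap ∘ ⟨ p , y ⟩ → cap ∘ ⟨ q , x ⟩ ≈ cap ∘ ⟨ q , y ⟩ → x ≈ y
    cap-separates {p} {q} plug {x} {y} eqp eqq = begin
      x ≈⟨ point-from-functional x ⟩
      r⇒ ∘ ((id ⊗₁ ((cap ∘ (Q ⊗point x)) ∘ r⇒)) ∘ (a⇒ ∘ ((cup ⊗₁ id) ∘ l⇐)))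
        ≈⟨ refl⟩∘⟨ ((refl⟩⊗⟨ (same ⟩∘⟨refl)) ⟩∘⟨refl) ⟩
      r⇒ ∘ ((id ⊗₁ ((cap ∘ (Q ⊗point y)) ∘ r⇒)) ∘ (a⇒ ∘ ((cup ⊗₁ id) ∘ l⇐)))
        ≈⟨ point-from-functional y ⟨
      y ∎
      where
      via : {z : unit ⇒ Q} → cap ∘ ⟨ z , x ⟩ ≈ cap ∘ ⟨ z , y ⟩ →
            (cap ∘ (Q ⊗point x)) ∘ z ≈ (cap ∘ (Q ⊗point y)) ∘ z
      via eq = ≈-trans (pullʳ ⊗point-∘) (≈-trans eq (≈-sym (pullʳ ⊗point-∘)))
      same : cap ∘ (Q ⊗point x) ≈ cap ∘ (Q ⊗point y)
      same = Equivalence.from (plug unit _ _) λ { true → via eqp ; false → via eqq }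

    IsCopyable : unit ⇒ Q → Set e
    IsCopyable x = δ ∘ x ≈ ⟨ x , x ⟩

    -- Phases: endomorphisms that commute with multiplication.

    module Phase (p : Q ⇒ Q) (p-μ : p ∘ μ ≈ μ ∘ (p ⊗₁ id)) where

      -- The unit law splits `μ`, so it suffices to compare after `μ`. There `frobeniusʳ`
      -- comultiplies the second factor while `p` acts on the first, and `p-μ` carries `p` to the
      -- output.
      δ-phase : δ ∘ p ≈ (p ⊗₁ id) ∘ δ
      δ-phase = retract⇒epi μ-unitˡ′ (begin
        (δ ∘ p) ∘ μ                                   ≈⟨ pullʳ p-μ ⟩
        δ ∘ (μ ∘ (p ⊗₁ id))                           ≈⟨ pullˡ (≈-sym frobeniusʳ) ⟩
        ((μ ⊗₁ id) ∘ (a⇐ ∘ (id ⊗₁ δ))) ∘ (p ⊗₁ id)    ≈⟨ pullʳ (pullʳ (≈-sym interchange)) ⟩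
        (μ ⊗₁ id) ∘ (a⇐ ∘ ((p ⊗₁ id) ∘ (id ⊗₁ δ)))    ≈⟨ refl⟩∘⟨ extendʳ (≈-trans (refl⟩∘⟨ refl⟩⊗⟨ ≈-sym ⊗-identity) a⇐-natural) ⟩
        (μ ⊗₁ id) ∘ (((p ⊗₁ id) ⊗₁ id) ∘ (a⇐ ∘ (id ⊗₁ δ))) ≈⟨ extendʳ (≈-trans mergeˡ (≈-trans (≈-sym p-μ ⟩⊗⟨refl) (≈-sym mergeˡ))) ⟩
        (p ⊗₁ id) ∘ ((μ ⊗₁ id) ∘ (a⇐ ∘ (id ⊗₁ δ)))    ≈⟨ refl⟩∘⟨ frobeniusʳ ⟩
        (p ⊗₁ id) ∘ (δ ∘ μ)                           ≈⟨ assoc ⟨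
        ((p ⊗₁ id) ∘ δ) ∘ μ                           ∎)

      -- By `δ-phase`, copying `p ∘ x` leaves `p` on the first copy only. The counit turns that copy
      -- into a scalar and keeps a plain `x`.
      phase-copyable : {x : unit ⇒ Q} → IsCopyable x → p ∘ x ≈ x ∘ (ε ∘ (p ∘ x))
      phase-copyable {x} copy = begin
        p ∘ x                               ≈⟨ cancelˡ l-isoʳ ⟨
        l⇒ ∘ (l⇐ ∘ (p ∘ x))                 ≈⟨ refl⟩∘⟨ (δ-counitˡ ⟩∘⟨refl) ⟨
        l⇒ ∘ (((ε ⊗₁ id) ∘ δ) ∘ (p ∘ x))    ≈⟨ refl⟩∘⟨ pullʳ (extendʳ δ-phase) ⟩
        l⇒ ∘ ((ε ⊗₁ id) ∘ ((p ⊗₁ id) ∘ (δ ∘ x))) ≈⟨ refl⟩∘⟨ refl⟩∘⟨ refl⟩∘⟨ copy ⟩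
        l⇒ ∘ ((ε ⊗₁ id) ∘ ((p ⊗₁ id) ∘ ⟨ x , x ⟩)) ≈⟨ refl⟩∘⟨ ≈-trans (refl⟩∘⟨ ⊗-⟨,⟩) ⊗-⟨,⟩ ⟩
        l⇒ ∘ ⟨ ε ∘ (p ∘ x) , id ∘ (id ∘ x) ⟩  ≈⟨ l⇒-⟨,⟩ ⟩
        (id ∘ (id ∘ x)) ∘ (ε ∘ (p ∘ x))     ≈⟨ ≈-trans identityˡ identityˡ ⟩∘⟨refl ⟩
        x ∘ (ε ∘ (p ∘ x))                   ∎

      μ-phaseˡ : {x y : unit ⇒ Q} → μ ∘ ⟨ p ∘ x , y ⟩ ≈ p ∘ (μ ∘ ⟨ x , y ⟩)
      μ-phaseˡ {x} {y} = begin
        μ ∘ ⟨ p ∘ x , y ⟩            ≈⟨ refl⟩∘⟨ ⟨,⟩-cong ≈-refl identityˡ ⟨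
        μ ∘ ⟨ p ∘ x , id ∘ y ⟩       ≈⟨ refl⟩∘⟨ ⊗-⟨,⟩ ⟨
        μ ∘ ((p ⊗₁ id) ∘ ⟨ x , y ⟩)  ≈⟨ extendʳ (≈-sym p-μ) ⟩
        p ∘ (μ ∘ ⟨ x , y ⟩)          ∎

      -- Commutativity lets `p` change factors, so `p` is self-adjoint for `cap`.
      cap-phase : {x y : unit ⇒ Q} → cap ∘ ⟨ x , p ∘ y ⟩ ≈ cap ∘ ⟨ p ∘ x , y ⟩
      cap-phase {x} {y} = begin
        cap ∘ ⟨ x , p ∘ y ⟩        ≈⟨ pullʳ μ-comm-⟨,⟩ ⟩
        ε ∘ (μ ∘ ⟨ p ∘ y , x ⟩)    ≈⟨ refl⟩∘⟨ μ-phaseˡ ⟩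
        ε ∘ (p ∘ (μ ∘ ⟨ y , x ⟩))  ≈⟨ refl⟩∘⟨ refl⟩∘⟨ μ-comm-⟨,⟩ ⟩
        ε ∘ (p ∘ (μ ∘ ⟨ x , y ⟩))  ≈⟨ refl⟩∘⟨ μ-phaseˡ ⟨
        ε ∘ (μ ∘ ⟨ p ∘ x , y ⟩)    ≈⟨ assoc ⟨
        cap ∘ ⟨ p ∘ x , y ⟩        ∎

-- The points zero and infinity of a GHZ/W-pair and the action of `×` on them.

module AdditiveInverse {o ℓ e} (C : SymmetricMonoidalCategory o ℓ e) where
  open SymmetricMonoidalCategory C
  open MonoidalLemmas C

  module Pair {Q : Obj} (ghz w : CFA C Q) (pair : IsGHZWPair C ghz w)
    (plug : IsPluggingSet C Q (pointPair C (CFA.η w) (τ C ghz w ∘ CFA.η w)))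
    (× : Q ⇒ Q) (×-involutive : × ∘ × ≈ id) (×-μ : × ∘ CFA.μ ghz ≈ CFA.μ ghz ∘ (× ⊗₁ id)) where

    private
      module G where
        open CFA ghz public
        open FrobeniusLemmas ghz public
        open Phase × ×-μ public
      module W where
        open CFA w public
        open FrobeniusLemmas w public
    open IsGHZWPair pair

    zeroPt infPt : unit ⇒ Q
    zeroPt = W.η
    infPt  = τ C ghz w ∘ W.η

    k l : unit ⇒ unit
    k = G.ε ∘ (× ∘ zeroPt)
    l = G.ε ∘ (× ∘ infPt)

    infPt-copyable : G.IsCopyable infPt
    infPt-copyable = begin
      G.δ ∘ (τ C ghz w ∘ W.η)                        ≈⟨ extendʳ pair-γ ⟩
      (τ C ghz w ⊗₁ τ C ghz w) ∘ (G.δ ∘ W.η)         ≈⟨ refl⟩∘⟨ pair-β ⟩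
      (τ C ghz w ⊗₁ τ C ghz w) ∘ ⟨ W.η , W.η ⟩       ≈⟨ ⊗-⟨,⟩ ⟩
      ⟨ infPt , infPt ⟩                              ∎

    ×-zeroPt : × ∘ zeroPt ≈ zeroPt ∘ k
    ×-zeroPt = G.phase-copyable pair-β

    ×-infPt : × ∘ infPt ≈ infPt ∘ l
    ×-infPt = G.phase-copyable infPt-copyable

    -- Says that `k` squares to one in its action on `zeroPt`, which is the form needed for
    -- distributivity.
    ×-involutive-zeroPt : (× ∘ zeroPt) ∘ k ≈ zeroPt
    ×-involutive-zeroPt = ≈-trans (pullʳ (≈-sym ×-zeroPt)) (cancelˡ ×-involutive)

    ×-involutive-infPt : (× ∘ infPt) ∘ l ≈ infPt
    ×-involutive-infPt = ≈-trans (pullʳ (≈-sym ×-infPt)) (cancelˡ ×-involutive)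

    square : unit ⇒ Q
    square = W.μ ∘ ⟨ infPt , infPt ⟩

    -- Passing from `G.cap` to `W.cap` strips `τ` from the first point and leaves the unit of the
    -- addition. The W-pairing of `infPt` with itself remains, and returning to `G.cap` by `pair-α`
    -- strips `τ` once more.
    cap-infPt-square : G.cap ∘ ⟨ infPt , square ⟩ ≈ G.cap ∘ ⟨ zeroPt , infPt ⟩
    cap-infPt-square = begin
      G.cap ∘ ⟨ infPt , square ⟩         ≈⟨ G.cap-transpose-⟨,⟩ ≈-refl ⟩
      W.cap ∘ ⟨ zeroPt , square ⟩        ≈⟨ pullʳ W.μ-unit-⟨,⟩ ⟩
      W.ε ∘ (W.μ ∘ ⟨ infPt , infPt ⟩)    ≈⟨ assoc ⟨
      W.cap ∘ ⟨ infPt , infPt ⟩          ≈⟨ W.cap-transpose-⟨,⟩ pair-α ⟩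
      G.cap ∘ ⟨ zeroPt , infPt ⟩         ∎

    -- Self-adjointness moves `×` onto `zeroPt`, where it acts as `k`. For `x` equal to `infPt`,
    -- where `×` acts as `l`, this makes both factors agree on the pairing of the two points.
    cap-zeroPt : {x : unit ⇒ Q} → G.cap ∘ ⟨ zeroPt , × ∘ x ⟩ ≈ (G.cap ∘ ⟨ zeroPt , x ⟩) ∘ k
    cap-zeroPt {x} = begin
      G.cap ∘ ⟨ zeroPt , × ∘ x ⟩   ≈⟨ G.cap-phase ⟩
      G.cap ∘ ⟨ × ∘ zeroPt , x ⟩   ≈⟨ refl⟩∘⟨ ⟨,⟩-cong ×-zeroPt ≈-refl ⟩
      G.cap ∘ ⟨ zeroPt ∘ k , x ⟩   ≈⟨ refl⟩∘⟨ ⟨,⟩-scalarˡ ⟩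
      G.cap ∘ (⟨ zeroPt , x ⟩ ∘ k) ≈⟨ assoc ⟨
      (G.cap ∘ ⟨ zeroPt , x ⟩) ∘ k ∎

    -- In FHilb, square is a multiple of zeroPt, because its infPt-component is the inner
    -- product of zeroPt and infPt.  Without orthogonality it is enough that k and l agree
    -- on this inner product.
    ×-square : × ∘ square ≈ square ∘ k
    ×-square = G.cap-separates plug
      (begin
        G.cap ∘ ⟨ zeroPt , × ∘ square ⟩   ≈⟨ cap-zeroPt ⟩
        (G.cap ∘ ⟨ zeroPt , square ⟩) ∘ k ≈⟨ pullʳ (≈-sym ⟨,⟩-scalarʳ) ⟩
        G.cap ∘ ⟨ zeroPt , square ∘ k ⟩   ∎)
      (begin
        G.cap ∘ ⟨ infPt , × ∘ square ⟩    ≈⟨ G.cap-phase ⟩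
        G.cap ∘ ⟨ × ∘ infPt , square ⟩    ≈⟨ refl⟩∘⟨ ⟨,⟩-cong ×-infPt ≈-refl ⟩
        G.cap ∘ ⟨ infPt ∘ l , square ⟩    ≈⟨ refl⟩∘⟨ ⟨,⟩-scalarˡ ⟩
        G.cap ∘ (⟨ infPt , square ⟩ ∘ l)  ≈⟨ pullˡ cap-infPt-square ⟩
        (G.cap ∘ ⟨ zeroPt , infPt ⟩) ∘ l  ≈⟨ pullʳ (≈-sym ⟨,⟩-scalarʳ) ⟩
        G.cap ∘ ⟨ zeroPt , infPt ∘ l ⟩    ≈⟨ refl⟩∘⟨ ⟨,⟩-cong ≈-refl ×-infPt ⟨
        G.cap ∘ ⟨ zeroPt , × ∘ infPt ⟩    ≈⟨ cap-zeroPt ⟩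
        (G.cap ∘ ⟨ zeroPt , infPt ⟩) ∘ k  ≈⟨ pullˡ cap-infPt-square ⟨
        G.cap ∘ (⟨ infPt , square ⟩ ∘ k)  ≈⟨ refl⟩∘⟨ ⟨,⟩-scalarʳ ⟨
        G.cap ∘ ⟨ infPt , square ∘ k ⟩    ∎)

    -- Distributivity of `×` over addition, up to `k`.

    DistributesOver : unit ⇒ Q → unit ⇒ Q → Set e
    DistributesOver x y = × ∘ (W.μ ∘ ⟨ x , y ⟩) ≈ (W.μ ∘ ⟨ × ∘ x , × ∘ y ⟩) ∘ k

    distributes-comm : {x y : unit ⇒ Q} → DistributesOver x y → DistributesOver y x
    distributes-comm d = ≈-trans (refl⟩∘⟨ W.μ-comm-⟨,⟩) (≈-trans d (W.μ-comm-⟨,⟩ ⟩∘⟨refl))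

    -- On the right side `×` also hits the unit of the addition and produces one `k`; the `∘ k` in
    -- `DistributesOver` is there to cancel it.
    distributes-zeroPt : (y : unit ⇒ Q) → DistributesOver zeroPt y
    distributes-zeroPt y = begin
      × ∘ (W.μ ∘ ⟨ zeroPt , y ⟩)              ≈⟨ refl⟩∘⟨ W.μ-unit-⟨,⟩ ⟩
      × ∘ y                                   ≈⟨ W.μ-unit-⟨,⟩ ⟨
      W.μ ∘ ⟨ zeroPt , × ∘ y ⟩                ≈⟨ refl⟩∘⟨ ⟨,⟩-cong ×-involutive-zeroPt ≈-refl ⟨
      W.μ ∘ ⟨ (× ∘ zeroPt) ∘ k , × ∘ y ⟩      ≈⟨ refl⟩∘⟨ ⟨,⟩-scalarˡ ⟩
      W.μ ∘ (⟨ × ∘ zeroPt , × ∘ y ⟩ ∘ k)      ≈⟨ assoc ⟨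
      (W.μ ∘ ⟨ × ∘ zeroPt , × ∘ y ⟩) ∘ k      ∎

    -- `×` on both summands contributes `l` twice, which is trivial on `infPt`; the remaining `k`
    -- comes from `×-square`.
    distributes-infPt : DistributesOver infPt infPt
    distributes-infPt = ≈-trans ×-square (∘-resp-≈ (begin
      W.μ ∘ ⟨ infPt , infPt ⟩                ≈⟨ refl⟩∘⟨ ⟨,⟩-cong ≈-refl ×-involutive-infPt ⟨
      W.μ ∘ ⟨ infPt , (× ∘ infPt) ∘ l ⟩      ≈⟨ refl⟩∘⟨ ⟨,⟩-scalarʳ ⟩
      W.μ ∘ (⟨ infPt , × ∘ infPt ⟩ ∘ l)      ≈⟨ refl⟩∘⟨ ⟨,⟩-scalarˡ ⟨
      W.μ ∘ ⟨ infPt ∘ l , × ∘ infPt ⟩        ≈⟨ refl⟩∘⟨ ⟨,⟩-cong ×-infPt ≈-refl ⟨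
      W.μ ∘ ⟨ × ∘ infPt , × ∘ infPt ⟩        ∎) ≈-refl)

    distributes-plug : (y : unit ⇒ Q) → DistributesOver zeroPt y → DistributesOver infPt y →
                       (x : unit ⇒ Q) → DistributesOver x y
    distributes-plug y d₀ d∞ x = ≈-trans (≈-sym left) (≈-trans (same ⟩∘⟨refl) right)
      where
      f g : Q ⇒ Q
      f = × ∘ (W.μ ∘ (Q ⊗point y))
      -- The scalar is absorbed into the fixed second point, so that `g` is a morphism out of `Q`.
      g = W.μ ∘ ((× ⊗₁ id) ∘ (Q ⊗point ((× ∘ y) ∘ k)))
      left : {z : unit ⇒ Q} → f ∘ z ≈ × ∘ (W.μ ∘ ⟨ z , y ⟩)
      left = pullʳ (pullʳ ⊗point-∘)
      right : {z : unit ⇒ Q} → g ∘ z ≈ (W.μ ∘ ⟨ × ∘ z , × ∘ y ⟩) ∘ k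
      right {z} = begin
        g ∘ z                                          ≈⟨ pullʳ (pullʳ ⊗point-∘) ⟩
        W.μ ∘ ((× ⊗₁ id) ∘ ⟨ z , (× ∘ y) ∘ k ⟩)        ≈⟨ refl⟩∘⟨ ⊗-⟨,⟩ ⟩
        W.μ ∘ ⟨ × ∘ z , id ∘ ((× ∘ y) ∘ k) ⟩           ≈⟨ refl⟩∘⟨ ⟨,⟩-cong ≈-refl identityˡ ⟩
        W.μ ∘ ⟨ × ∘ z , (× ∘ y) ∘ k ⟩                  ≈⟨ refl⟩∘⟨ ⟨,⟩-scalarʳ ⟩
        W.μ ∘ (⟨ × ∘ z , × ∘ y ⟩ ∘ k)                  ≈⟨ assoc ⟨
        (W.μ ∘ ⟨ × ∘ z , × ∘ y ⟩) ∘ k                  ∎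
      same : f ≈ g
      same = Equivalence.from (plug Q f g) λ
        { true  → ≈-trans left (≈-trans d₀ (≈-sym right))
        ; false → ≈-trans left (≈-trans d∞ (≈-sym right)) }

    -- Plugging into the first slot leaves `infPt` against `y`. After a swap, plugging in place of
    -- `y` leaves only `infPt` against itself.
    distributes : (x y : unit ⇒ Q) → DistributesOver x y
    distributes x y = distributes-plug y (distributes-zeroPt y)
      (distributes-comm
        (distributes-plug infPt (distributes-zeroPt infPt) distributes-infPt y)) x

    -- Eigenvectors of `×` for the eigenvalue `k`.

    ×-eigenvector : (ψ : unit ⇒ Q) →
      × ∘ (W.μ ∘ ⟨ ψ , × ∘ ψ ⟩) ≈ (W.μ ∘ ⟨ ψ , × ∘ ψ ⟩) ∘ k
    ×-eigenvector ψ = begin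
      × ∘ (W.μ ∘ ⟨ ψ , × ∘ ψ ⟩)               ≈⟨ distributes ψ (× ∘ ψ) ⟩
      (W.μ ∘ ⟨ × ∘ ψ , × ∘ (× ∘ ψ) ⟩) ∘ k     ≈⟨ (refl⟩∘⟨ ⟨,⟩-cong ≈-refl (cancelˡ ×-involutive)) ⟩∘⟨refl ⟩
      (W.μ ∘ ⟨ × ∘ ψ , ψ ⟩) ∘ k               ≈⟨ W.μ-comm-⟨,⟩ ⟩∘⟨refl ⟩
      (W.μ ∘ ⟨ ψ , × ∘ ψ ⟩) ∘ k               ∎

    -- The scalar ε∘ ∘ η• need not be the identity, but it acts trivially on Q.
    εη-absorb : (x : unit ⇒ Q) → x ∘ (G.ε ∘ zeroPt) ≈ x
    εη-absorb x = begin
      x ∘ (G.ε ∘ zeroPt)                        ≈⟨ W.μ-unit-⟨,⟩ ⟩∘⟨refl ⟨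
      (W.μ ∘ ⟨ zeroPt , x ⟩) ∘ (G.ε ∘ zeroPt)   ≈⟨ pullʳ (≈-sym ⟨,⟩-scalarˡ) ⟩
      W.μ ∘ ⟨ zeroPt ∘ (G.ε ∘ zeroPt) , x ⟩     ≈⟨ refl⟩∘⟨ ⟨,⟩-cong zeroPt-absorb ≈-refl ⟩
      W.μ ∘ ⟨ zeroPt , x ⟩                      ≈⟨ W.μ-unit-⟨,⟩ ⟩
      x                                         ∎
      where
      -- The identity is a phase, and the scalar that `phase-copyable` gives for it is the counit of
      -- the point.
      module Id = G.Phase id (≈-trans identityˡ (≈-sym (≈-trans (refl⟩∘⟨ ⊗-identity) identityʳ)))
      zeroPt-absorb : zeroPt ∘ (G.ε ∘ zeroPt) ≈ zeroPt
      zeroPt-absorb = begin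
        zeroPt ∘ (G.ε ∘ zeroPt)          ≈⟨ refl⟩∘⟨ refl⟩∘⟨ identityˡ ⟨
        zeroPt ∘ (G.ε ∘ (id ∘ zeroPt))   ≈⟨ Id.phase-copyable pair-β ⟨
        id ∘ zeroPt                      ≈⟨ identityˡ ⟩
        zeroPt                           ∎

    -- Pairing with `G.η` is `G.ε`, and pairing with `× ∘ G.η` is `G.ε ∘ ×`, which on an eigenvector
    -- is again fixed by `G.ε`. Both sides are eigenvectors for `k` with the same value under `G.ε`.
    eigenvector⇒multiple-of-zeroPt : IsPluggingSet C Q (pointPair C G.η (× ∘ G.η)) →
      {x : unit ⇒ Q} → × ∘ x ≈ x ∘ k → x ≈ zeroPt ∘ (G.ε ∘ x)
    eigenvector⇒multiple-of-zeroPt plug∘ {x} eig = G.cap-separates plug∘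
      (begin
        G.cap ∘ ⟨ G.η , x ⟩                     ≈⟨ pullʳ G.μ-unit-⟨,⟩ ⟩
        G.ε ∘ x                                 ≈⟨ ε-multiple ⟨
        G.ε ∘ (zeroPt ∘ (G.ε ∘ x))              ≈⟨ pullʳ G.μ-unit-⟨,⟩ ⟨
        G.cap ∘ ⟨ G.η , zeroPt ∘ (G.ε ∘ x) ⟩    ∎)
      (begin
        G.cap ∘ ⟨ × ∘ G.η , x ⟩                 ≈⟨ cap-×η ⟩
        G.ε ∘ (× ∘ x)                           ≈⟨ refl⟩∘⟨ eig ⟩
        G.ε ∘ (x ∘ k)                           ≈⟨ assoc ⟨
        (G.ε ∘ x) ∘ k                           ≈⟨ ε-multiple ⟩∘⟨refl ⟨
        (G.ε ∘ (zeroPt ∘ (G.ε ∘ x))) ∘ k        ≈⟨ pullʳ (pullʳ scalar-comm) ⟩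
        G.ε ∘ (zeroPt ∘ (k ∘ (G.ε ∘ x)))        ≈⟨ refl⟩∘⟨ extendʳ ×-zeroPt ⟨
        G.ε ∘ (× ∘ (zeroPt ∘ (G.ε ∘ x)))        ≈⟨ cap-×η ⟨
        G.cap ∘ ⟨ × ∘ G.η , zeroPt ∘ (G.ε ∘ x) ⟩ ∎)
      where
      ε-multiple : G.ε ∘ (zeroPt ∘ (G.ε ∘ x)) ≈ G.ε ∘ x
      ε-multiple = begin
        G.ε ∘ (zeroPt ∘ (G.ε ∘ x))   ≈⟨ assoc ⟨
        (G.ε ∘ zeroPt) ∘ (G.ε ∘ x)   ≈⟨ scalar-comm ⟩
        (G.ε ∘ x) ∘ (G.ε ∘ zeroPt)   ≈⟨ pullʳ (εη-absorb x) ⟩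
        G.ε ∘ x                      ∎
      cap-×η : {y : unit ⇒ Q} → G.cap ∘ ⟨ × ∘ G.η , y ⟩ ≈ G.ε ∘ (× ∘ y)
      cap-×η = ≈-trans (≈-sym G.cap-phase) (pullʳ G.μ-unit-⟨,⟩)

theorem4p4 : ∀ {o ℓ e} (C : SymmetricMonoidalCategory o ℓ e) →
    let open SymmetricMonoidalCategory C in
    NoNontrivialInvertibleScalars C →
    (Q : Obj) (ghz w : CFA C Q) → IsGHZWPair C ghz w →
    IsPluggingSet C Q (pointPair C (CFA.η w) (τ C ghz w ∘ CFA.η w)) →
    (× : Q ⇒ Q) → × ∘ × ≈ id → × ∘ CFA.μ ghz ≈ CFA.μ ghz ∘ (× ⊗₁ id) →
    IsPluggingSet C Q (pointPair C (CFA.η ghz) (× ∘ CFA.η ghz)) →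
    (ψ : unit ⇒ Q) →
    CFA.μ w ∘ ((ψ ⊗₁ (× ∘ ψ)) ∘ l⇐)
    ≈ _·_ C (CFA.ε ghz ∘ (CFA.μ w ∘ ((ψ ⊗₁ (× ∘ ψ)) ∘ l⇐))) (CFA.η w)
theorem4p4 C _ Q ghz w pair plug × ×-involutive ×-μ plug∘ ψ =
  ≈-trans (eigenvector⇒multiple-of-zeroPt plug∘ (×-eigenvector ψ)) (≈-sym l⇒-⟨,⟩)
  where
  open MonoidalLemmas C
  open AdditiveInverse.Pair C ghz w pair plug × ×-involutive ×-μ
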